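{- There exists a function $N:\mathbb{N}\to\mathbb{N}$ such that for every positive integer $d$, every $S\subset\mathbb{R}^d$ and every family $F$ of axis-parallel boxes in $\mathbb{R}^d$ with $|F|=N(d)$, if every pair of members of $F$ is $S$-intersecting, then $F$ contains an $S$-intersecting subfamily of size $d+1$.
   Context: $\mathbb{N}$ is the set of positive integers. An axis-parallel box in $\mathbb{R}^d$ is a product of $d$ nonempty closed intervals of $\mathbb{R}$ (all boxes are closed). A family is a finite indexed collection $\{B_1,\dots,B_n\}$, possibly with repeated members, and $|F|=n$; pairs are pairs of distinct indices. Given a set $S$, a nonempty (sub)family of sets is $S$-intersecting if the intersection of all its members contains a point of $S$. -}

module Defs where

open import Data.Fin.Base using (Fin)
open import Data.Fin.Subset using (Subset; Nonempty) renaming (_∈_ to _∈ᶠ_)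
open import Data.Nat.Base using (ℕ; NonZero)
open import Data.Product.Base using (_×_; _,_; ∃)
open import Data.Rational.Base using (ℚ) renaming (_<_ to _<ℚ_)
open import Data.Refinement using (Refinement)
open import Data.Sum.Base using (_⊎_)
open import Data.Vec.Functional using (Vector)
open import Function.Bundles using (_⇔_)
open import Level using (Level; 0ℓ; suc; _⊔_)
open import Relation.Nullary.Negation.Core using (¬_)
open import Relation.Unary using (Pred; _∈_; _⊆_)

ℕ⁺ : Set
ℕ⁺ = Refinement ℕ NonZero

-- Two-sided Dedekind cuts of rationals: L q means q < x, and U q means x < q.
record ℝ : Set₁ where
  field
    L U         : Pred ℚ 0ℓ
    L-inhabited : ∃ L
    U-inhabited : ∃ U
    L-rounded   : ∀ q → L q ⇔ (∃ λ r → q <ℚ r × L r)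
    U-rounded   : ∀ q → U q ⇔ (∃ λ r → r <ℚ q × U r)
    disjoint    : ∀ q → ¬ (L q × U q)
    located     : ∀ {q r} → q <ℚ r → L q ⊎ U r

infix 4 _≤_ _≈_ _≋_

-- The lower half of a located cut determines its upper half, so comparing
-- lower halves is enough.
_≤_ : ℝ → ℝ → Set
x ≤ y = ℝ.L x ⊆ ℝ.L y

-- Equality of reals: distinct records may present the same cut.
_≈_ : ℝ → ℝ → Set
x ≈ y = x ≤ y × y ≤ x

Point : ℕ → Set₁
Point d = Vector ℝ d

_≋_ : ∀ {d} → Point d → Point d → Set
x ≋ y = ∀ k → x k ≈ y k

record ClosedInterval : Set₁ where
  field
    lower upper : ℝ
    lower≤upper : lower ≤ upper

⟦_⟧ : ClosedInterval → Pred ℝ 0ℓ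
⟦ I ⟧ x = lower ≤ x × x ≤ upper
  where open ClosedInterval I

Box : ℕ → Set₁
Box d = Vector ClosedInterval d

⟦_⟧ᵇ : ∀ {d} → Box d → Pred (Point d) 0ℓ
⟦ B ⟧ᵇ x = ∀ k → x k ∈ ⟦ B k ⟧

Family : ℕ → ℕ → Set₁
Family d n = Vector (Box d) n

-- A subfamily is given by its set I of indices, so repeated members of F
-- count separately.
SIntersecting : ∀ {ℓ d n} → Pred (Point d) ℓ → Family d n → Subset n → Set (suc 0ℓ ⊔ ℓ)
SIntersecting S F I =
  Nonempty I × (∃ λ x → x ∈ S × (∀ i → i ∈ᶠ I → x ∈ ⟦ F i ⟧ᵇ))

{-# OPTIONS --safe #-}

-- By iterating the Erdős–Szekeres argument over the 2d endpoint coordinates,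
-- a large family of boxes contains a sequence of d+1 boxes along which every
-- lower and every upper endpoint is monotone.  Each endpoint of a box of the
-- sequence then lies between the corresponding endpoints of the first and the
-- last box, so a point common to these two lies in all boxes of the sequence.

module Submission where

open import Defs
open import Axiom.ExcludedMiddle using (ExcludedMiddle)
open import Data.Empty using (⊥-elim)
open import Data.Fin.Base using (Fin; zero; suc)
open import Data.Fin.Subset
  using (Subset; ⁅_⁆; _∪_; ⋃; ∣_∣; inside; outside)
  renaming (_∈_ to _∈ᶠ_; _∉_ to _∉ᶠ_)
open import Data.Fin.Subset.Properties
  using (∉⊥; ∣⊥∣≡0; x∈⁅x⁆; x∈⁅y⁆⇒x≡y; x∈p∪q⁺; x∈p∪q⁻; ∪-identityˡ)
open import Data.Irrelevant using ([_])
open import Data.List.Base using (List; []; _∷_; _∷ʳ_; allFin; initLast; _∷ʳ′_; length; map; take)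
open import Data.List.Membership.Propositional using (_∈_)
open import Data.List.Membership.Propositional.Properties using (∈-++⁺ʳ)
open import Data.List.Properties using (length-take; length-tabulate)
open import Data.List.Relation.Binary.Sublist.Propositional
  using (_⊆_; []; _∷_; ⊆-trans; minimum)
  renaming (_∷ʳ_ to infixr 5 _∷ˢ_)
open import Data.List.Relation.Binary.Sublist.Propositional.Properties using (All-resp-⊆; take-⊆)
open import Data.List.Relation.Unary.All as All using (All; []; _∷_)
open import Data.List.Relation.Unary.AllPairs using (AllPairs; []; _∷_)
open import Data.List.Relation.Unary.Any using (here; there)
open import Data.List.Relation.Unary.Unique.Propositional using (Unique)
open import Data.List.Relation.Unary.Unique.Propositional.Properties using (allFin⁺)
open import Data.Nat.Base as ℕ using (ℕ; zero; suc; _+_; s≤s⁻¹)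
import Data.Nat.Properties as ℕ
open import Data.Product.Base using (_×_; _,_; ∃; proj₁; proj₂)
open import Data.Rational.Base using () renaming (_≤_ to _≤ℚ_)
import Data.Rational.Properties as ℚ
open import Data.Refinement using (value; _,_)
open import Data.Sum.Base as Sum using (_⊎_; inj₁; inj₂; [_,_]′)
open import Data.Vec.Base using (_∷_; here; there)
open import Function.Base using (_∘_; case_of_; flip)
open import Function.Bundles using (Equivalence)
open import Level using (Level; 0ℓ)
open import Relation.Binary.Core using (Rel)
open import Relation.Binary.Definitions using (_Respects_; Reflexive; Total)
open import Relation.Binary.PropositionalEquality.Core
  using (_≡_; _≢_; refl; sym; trans; cong; subst)
open import Relation.Nullary.Decidable.Core using (yes; no)
open import Relation.Nullary.Negation.Core using (contradiction)
open import Relation.Unary using (Pred)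

private
  variable
    a p q : Level
    A : Set a
    n : ℕ

-- Pairwise related lists and their ends

AllPairs-resp-⊆ : {R : Rel A p} {xs ys : List A} → xs ⊆ ys → AllPairs R ys → AllPairs R xs
AllPairs-resp-⊆ []          []       = []
AllPairs-resp-⊆ (_ ∷ˢ τ)    (_ ∷ rs) = AllPairs-resp-⊆ τ rs
AllPairs-resp-⊆ (refl ∷ τ)  (r ∷ rs) = All-resp-⊆ τ r ∷ AllPairs-resp-⊆ τ rs

AllPairs-last : {R : Rel A p} → Reflexive R → ∀ xs {y t} →
                AllPairs R (xs ∷ʳ y) → t ∈ xs ∷ʳ y → R t y
AllPairs-last rfl []       _        (here refl) = rfl
AllPairs-last rfl (x ∷ xs) (r ∷ _)  (here refl) = All.lookup r (∈-++⁺ʳ xs (here refl))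
AllPairs-last rfl (x ∷ xs) (_ ∷ rs) (there t∈)  = AllPairs-last rfl xs rs t∈

AllPairs-head : {R : Rel A p} → Reflexive R → ∀ {x xs t} →
                AllPairs R (x ∷ xs) → t ∈ x ∷ xs → R x t
AllPairs-head rfl (_ ∷ _) (here refl) = rfl
AllPairs-head rfl (r ∷ _) (there t∈)  = All.lookup r t∈

-- Ramsey's theorem for ordered pairs in a list

split-⊎ : {P : Pred A p} {Q : Pred A q} → (∀ x → P x ⊎ Q x) → ∀ xs →
          ∃ λ ys → ∃ λ zs → ys ⊆ xs × zs ⊆ xs × All P ys × All Q zs ×
          length ys + length zs ≡ length xs
split-⊎ P⊎Q []       = [] , [] , [] , [] , [] , [] , refl
split-⊎ P⊎Q (x ∷ xs) with split-⊎ P⊎Q xs | P⊎Q x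
... | ys , zs , ys⊆ , zs⊆ , ps , qs , eq | inj₁ px =
  x ∷ ys , zs , refl ∷ ys⊆ , x ∷ˢ zs⊆ , px ∷ ps , qs , cong suc eq
... | ys , zs , ys⊆ , zs⊆ , ps , qs , eq | inj₂ qx =
  ys , x ∷ zs , x ∷ˢ ys⊆ , refl ∷ zs⊆ , ps , qx ∷ qs ,
  trans (ℕ.+-suc (length ys) (length zs)) (cong suc eq)

+-≤-split : ∀ k l {m n} → k + l ℕ.≤ m + n → k ℕ.≤ m ⊎ l ℕ.≤ n
+-≤-split k l {m} {n} k+l≤m+n with k ℕ.≤? m | l ℕ.≤? n
... | yes k≤m | _       = inj₁ k≤m
... | no  _   | yes l≤n = inj₂ l≤n
... | no  k≰m | no  l≰n =
  contradiction k+l≤m+n (ℕ.<⇒≱ (ℕ.+-mono-< (ℕ.≰⇒> k≰m) (ℕ.≰⇒> l≰n)))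

-- In closed form, the binomial coefficient of `k + l` over `k`, minus 1.
ramseyBound : ℕ → ℕ → ℕ
ramseyBound zero    _       = 0
ramseyBound (suc k) zero    = 0
ramseyBound (suc k) (suc l) = suc (ramseyBound k (suc l) + ramseyBound (suc k) l)

-- The head colours the tail by its relation to each entry. By pigeonhole one colour class is long
-- enough to recurse on, and a sublist found there in that same colour can be extended by the head.
ramsey : {P : Rel A p} {Q : Rel A q} → (∀ x y → P x y ⊎ Q x y) →
         ∀ k l xs → ramseyBound k l ℕ.≤ length xs →
         ∃ λ ys → ys ⊆ xs × (length ys ≡ k × AllPairs P ys ⊎ length ys ≡ l × AllPairs Q ys)
ramsey P⊎Q zero    l       xs       _ = [] , minimum xs , inj₁ (refl , [])
ramsey P⊎Q (suc k) zero    xs       _ = [] , minimum xs , inj₂ (refl , [])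
ramsey P⊎Q (suc k) (suc l) (x ∷ xs) b≤
  with ys , zs , ys⊆ , zs⊆ , ps , qs , eq ← split-⊎ (P⊎Q x) xs
  with +-≤-split (ramseyBound k (suc l)) (ramseyBound (suc k) l)
                 (subst (_ ℕ.≤_) (sym eq) (s≤s⁻¹ b≤))
... | inj₁ b≤ys = case ramsey P⊎Q k (suc l) ys b≤ys of λ where
  (ws , ws⊆ , inj₁ (len , pairs)) →
    x ∷ ws , refl ∷ ⊆-trans ws⊆ ys⊆ , inj₁ (cong suc len , All-resp-⊆ ws⊆ ps ∷ pairs)
  (ws , ws⊆ , inj₂ r) → ws , x ∷ˢ ⊆-trans ws⊆ ys⊆ , inj₂ r
... | inj₂ b≤zs = case ramsey P⊎Q (suc k) l zs b≤zs of λ where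
  (ws , ws⊆ , inj₁ r) → ws , x ∷ˢ ⊆-trans ws⊆ zs⊆ , inj₁ r
  (ws , ws⊆ , inj₂ (len , pairs)) →
    x ∷ ws , refl ∷ ⊆-trans ws⊆ zs⊆ , inj₂ (cong suc len , All-resp-⊆ ws⊆ qs ∷ pairs)

-- Simultaneously monotone sublists

Monotone : Rel A p → List A → Set _
Monotone R xs = AllPairs R xs ⊎ AllPairs (flip R) xs

Monotone-resp-⊆ : {R : Rel A p} {xs ys : List A} → xs ⊆ ys → Monotone R ys → Monotone R xs
Monotone-resp-⊆ τ = Sum.map (AllPairs-resp-⊆ τ) (AllPairs-resp-⊆ τ)

-- Each relation costs one diagonal Ramsey bound, so the bounds nest `m` deep.
monotoneBound : ℕ → ℕ → ℕ
monotoneBound zero    k = k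
monotoneBound (suc m) k = ramseyBound (monotoneBound m k) (monotoneBound m k)

monotoneSublist : ∀ {m} {R : Fin m → Rel A p} → (∀ i → Total (R i)) →
                  ∀ k xs → monotoneBound m k ℕ.≤ length xs →
                  ∃ λ ys → ys ⊆ xs × length ys ≡ k × (∀ i → Monotone (R i) ys)
monotoneSublist {m = zero} total k xs b≤ =
  take k xs , take-⊆ k xs , trans (length-take k xs) (ℕ.m≤n⇒m⊓n≡m b≤) , λ ()
monotoneSublist {m = suc m} {R} total k xs b≤
  -- Totality is itself a two-colouring of ordered pairs, by `R zero` and its converse.
  with ys , ys⊆ , r ← ramsey (total zero) (monotoneBound m k) (monotoneBound m k) xs b≤
  with zs , zs⊆ , len , mono ← monotoneSublist (total ∘ suc) k ys
                                 (ℕ.≤-reflexive (sym ([ proj₁ , proj₁ ]′ r)))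
  = zs , ⊆-trans zs⊆ ys⊆ , len , λ where
      zero    → Monotone-resp-⊆ {R = R zero} zs⊆ (Sum.map proj₂ proj₂ r)
      (suc i) → mono i

-- A maximum sits at the last entry of an ascending list and at the first entry of a descending one.
Monotone-≤-ends : {R : Rel A p} → Reflexive R → ∀ {x} xs {y t} →
                  Monotone R (x ∷ xs ∷ʳ y) → t ∈ x ∷ xs ∷ʳ y → R t x ⊎ R t y
Monotone-≤-ends rfl {x} xs (inj₁ up)   t∈ = inj₂ (AllPairs-last rfl (x ∷ xs) up t∈)
Monotone-≤-ends rfl xs     (inj₂ down) t∈ = inj₁ (AllPairs-head rfl down t∈)

Monotone-≥-ends : {R : Rel A p} → Reflexive R → ∀ {x} xs {y t} →
                  Monotone R (x ∷ xs ∷ʳ y) → t ∈ x ∷ xs ∷ʳ y → R x t ⊎ R y t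
-- Passing to the converse relation exchanges ascending with descending.
Monotone-≥-ends {R = R} rfl xs mono = Monotone-≤-ends {R = flip R} rfl xs (Sum.swap mono)

-- Index lists as index sets

∣⁅x⁆∪p∣≡1+∣p∣ : ∀ {x : Fin n} {p} → x ∉ᶠ p → ∣ ⁅ x ⁆ ∪ p ∣ ≡ suc ∣ p ∣
∣⁅x⁆∪p∣≡1+∣p∣ {x = zero}  {inside ∷ p}  x∉p = contradiction here x∉p
∣⁅x⁆∪p∣≡1+∣p∣ {x = zero}  {outside ∷ p} x∉p = cong (suc ∘ ∣_∣) (∪-identityˡ p)
∣⁅x⁆∪p∣≡1+∣p∣ {x = suc x} {inside ∷ p}  x∉p = cong suc (∣⁅x⁆∪p∣≡1+∣p∣ (x∉p ∘ there))
∣⁅x⁆∪p∣≡1+∣p∣ {x = suc x} {outside ∷ p} x∉p = ∣⁅x⁆∪p∣≡1+∣p∣ (x∉p ∘ there)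

fromList : List (Fin n) → Subset n
fromList xs = ⋃ (map ⁅_⁆ xs)

∈-fromList⁻ : ∀ {x : Fin n} xs → x ∈ᶠ fromList xs → x ∈ xs
∈-fromList⁻ []       x∈ = contradiction x∈ ∉⊥
∈-fromList⁻ (y ∷ xs) x∈ =
  [ here ∘ x∈⁅y⁆⇒x≡y y , there ∘ ∈-fromList⁻ xs ]′ (x∈p∪q⁻ ⁅ y ⁆ (fromList xs) x∈)

∣fromList∣ : {xs : List (Fin n)} → Unique xs → ∣ fromList xs ∣ ≡ length xs
∣fromList∣ {n = n} []           = ∣⊥∣≡0 n
∣fromList∣ {xs = x ∷ xs} (x≢ ∷ u) =
  trans (∣⁅x⁆∪p∣≡1+∣p∣ (λ x∈ → All.lookup x≢ (∈-fromList⁻ xs x∈) refl))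
        (cong suc (∣fromList∣ u))

-- The order on the reals

L-lower : ∀ (x : ℝ) {q r} → q ≤ℚ r → ℝ.L x r → ℝ.L x q
L-lower x {q} {r} q≤r Lr
  -- The element `s` of the cut above `r` is also above `q`, so roundedness read backwards yields
  -- `q`.
  with s , r<s , Ls ← Equivalence.to (ℝ.L-rounded x r) Lr
  = Equivalence.from (ℝ.L-rounded x q) (s , ℚ.≤-<-trans q≤r r<s , Ls)

-- If some `q` lies in the lower cut of `x` but not in that of `y`, then all of the latter lies
-- below `q`, hence in the lower cut of `x`.
≤-total : ExcludedMiddle 0ℓ → Total _≤_
≤-total em x y with em {y ≤ x}
... | yes y≤x = inj₂ y≤x
... | no  y≰x = inj₁ λ {q} Lxq → below q Lxq
  where
  below : ∀ q → ℝ.L x q → ℝ.L y q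
  below q Lxq with em {ℝ.L y q}
  ... | yes Lyq = Lyq
  ... | no ¬Lyq = ⊥-elim (y≰x y≤x)
    where
    y≤x : y ≤ x
    y≤x {r} Lyr with ℚ.≤-total r q
    ... | inj₁ r≤q = L-lower x r≤q Lxq
    ... | inj₂ q≤r = contradiction (L-lower y q≤r Lyr) ¬Lyq

-- Boxes with monotone endpoints

module _ {d} (F : Family d n) where
  open ClosedInterval

  -- Indices are compared rather than boxes, so repeated members stay distinct.
  LowerEnd UpperEnd : Fin d → Rel (Fin n) 0ℓ
  LowerEnd k i j = lower (F i k) ≤ lower (F j k)
  UpperEnd k i j = upper (F i k) ≤ upper (F j k)

  ends-∩-⊆ : ∀ {a} js {b x t} →
             (∀ k → Monotone (LowerEnd k) (a ∷ js ∷ʳ b)) →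
             (∀ k → Monotone (UpperEnd k) (a ∷ js ∷ʳ b)) →
             ⟦ F a ⟧ᵇ x → ⟦ F b ⟧ᵇ x → t ∈ a ∷ js ∷ʳ b → ⟦ F t ⟧ᵇ x
  ends-∩-⊆ {a} js {b} {x} {t} lo up x∈a x∈b t∈ k =
    above (Monotone-≤-ends {R = LowerEnd k} (λ l → l) js (lo k) t∈) ,
    below (Monotone-≥-ends {R = UpperEnd k} (λ u → u) js (up k) t∈)
    where
    above : LowerEnd k t a ⊎ LowerEnd k t b → lower (F t k) ≤ x k
    -- As `_≤_` is inclusion of lower cuts, transitivity is composition of functions.
    above (inj₁ t≤a) l = proj₁ (x∈a k) (t≤a l)
    above (inj₂ t≤b) l = proj₁ (x∈b k) (t≤b l)

    below : UpperEnd k a t ⊎ UpperEnd k b t → x k ≤ upper (F t k)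
    below (inj₁ a≤t) l = a≤t (proj₂ (x∈a k) l)
    below (inj₂ b≤t) l = b≤t (proj₂ (x∈b k) l)

  monotone⇒SIntersecting :
    ∀ {ℓ} (S : Pred (Point d) ℓ) →
    (∀ i j → i ≢ j → SIntersecting S F (⁅ i ⁆ ∪ ⁅ j ⁆)) →
    ∀ {m} js → length js ≡ suc (suc m) → Unique js →
    (∀ k → Monotone (LowerEnd k) js) → (∀ k → Monotone (UpperEnd k) js) →
    SIntersecting S F (fromList js)
  monotone⇒SIntersecting S pairwise (a ∷ js) len u lo up with initLast js
  -- The length is at least two, so there is a last index `b`, and uniqueness makes it differ from
  -- `a`. The point of `S` shared by these two boxes serves for the whole list.
  monotone⇒SIntersecting S pairwise (a ∷ .(js ∷ʳ b)) len (a≢ ∷ _) lo up | js ∷ʳ′ b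
    with _ , x , x∈S , x∈F ← pairwise a b (All.lookup a≢ (∈-++⁺ʳ js (here refl)))
    = (a , x∈p∪q⁺ (inj₁ (x∈⁅x⁆ a))) , x , x∈S , λ t t∈ →
      ends-∩-⊆ js {x = x} lo up (x∈F a (x∈p∪q⁺ (inj₁ (x∈⁅x⁆ a)))) (x∈F b (x∈p∪q⁺ (inj₂ (x∈⁅x⁆ b))))
        (∈-fromList⁻ (a ∷ js ∷ʳ b) t∈)

  -- The outer bound pays for the `d` lower endpoints, the inner one for the `d` upper endpoints.
  -- The second pass takes a sublist, which keeps the monotonicity gained in the first.
  pairwise⇒SIntersecting :
    ∀ {ℓ} (S : Pred (Point d) ℓ) →
    ExcludedMiddle 0ℓ → (∀ i j → i ≢ j → SIntersecting S F (⁅ i ⁆ ∪ ⁅ j ⁆)) →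
    ∀ m → monotoneBound d (monotoneBound d (suc (suc m))) ℕ.≤ n →
    ∃ λ I → ∣ I ∣ ≡ suc (suc m) × SIntersecting S F I
  pairwise⇒SIntersecting S em pairwise m b≤n
    with js , js⊆ , lenj , lo ← monotoneSublist {R = LowerEnd}
           (λ k i j → ≤-total em (lower (F i k)) (lower (F j k)))
           (monotoneBound d (suc (suc m))) (allFin n)
           (subst (_ ℕ.≤_) (sym (length-tabulate {n = n} (λ i → i))) b≤n)
    with is , is⊆ , leni , up ← monotoneSublist {R = UpperEnd}
           (λ k i j → ≤-total em (upper (F i k)) (upper (F j k)))
           (suc (suc m)) js (ℕ.≤-reflexive (sym lenj))
    = fromList is , trans (∣fromList∣ unique) leni ,
      monotone⇒SIntersecting S pairwise is leni unique
        (λ k → Monotone-resp-⊆ {R = LowerEnd k} is⊆ (lo k)) up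
    where
    unique : Unique is
    unique = AllPairs-resp-⊆ (⊆-trans is⊆ js⊆) (allFin⁺ n)

theorem1p3 : ∀ {ℓ} → ExcludedMiddle 0ℓ →
    ∃ λ (N : ℕ⁺ → ℕ⁺) →
    ∀ (d : ℕ⁺) (S : Pred (Point (value d)) ℓ) → S Respects _≋_ →
    (F : Family (value d) (value (N d))) →
    (∀ i j → i ≢ j → SIntersecting S F (⁅ i ⁆ ∪ ⁅ j ⁆)) →
    ∃ λ I → ∣ I ∣ ≡ suc (value d) × SIntersecting S F I
theorem1p3 em = N , λ where
    (zero , [ () ])
    -- A positive dimension makes the target size at least two, as the choice of two ends requires;
    -- the inequality absorbs the extra `suc` in `N`.
    (suc d , _) S _ F pairwise → pairwise⇒SIntersecting F S em pairwise d (ℕ.n≤1+n _)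
  where
  N : ℕ⁺ → ℕ⁺
  -- The leading `suc` makes the value nonzero by computation.
  N (d , _) = suc (monotoneBound d (monotoneBound d (suc d))) , [ _ ]
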